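{- Let $\Sigma$ be a set of sp-implications such that every $\sigma\to\tau$ in $\Sigma$ satisfies: (i) every variable occurring in $\tau$ occurs in $\sigma$ exactly once; (ii) $|W_\tau|\ge 2$ and every point of every $\mathfrak v_\tau(p)$ is a leaf of $\mathfrak T_\tau$; (iii) $\mathfrak v_\tau(p)\cap\mathfrak v_\tau(q)=\emptyset$ whenever $p\neq q$. Then the spi-logic $\mathsf{SPi}+\Sigma$ is complex, and hence complete.
   Context: Fix a non-empty signature $\mathcal{R}$. Sp-formulas are built from propositional variables and $\top$ using $\wedge$ and unary diamonds $\Diamond_R$ ($R\in\mathcal R$); an sp-implication is $\sigma\to\tau$ with $\sigma,\tau$ sp-formulas. A SLO is an algebra $(A,\wedge,\top,\Diamond_R)_{R\in\mathcal R}$ where $(A,\wedge,\top)$ is a meet-semilattice with top $\top$ and each $\Diamond_R$ is monotone; it validates $\sigma\to\tau$ if $\sigma[\mathfrak a]\le\tau[\mathfrak a]$ for all valuations $\mathfrak a$. Frames $\mathfrak F=(W,R^{\mathfrak F})_{R\in\mathcal R}$ and validity of sp-implications in frames are as in standard Kripke semantics. $\Sigma\models_{\mathsf{Kr}}\iota$ (resp. $\Sigma\models_{\mathsf{SLO}}\iota$) means $\iota$ is valid in every frame (resp. SLO) validating $\Sigma$. The spi-logic $\mathsf{SPi}+\Sigma$ is $\{\iota\mid\Sigma\models_{\mathsf{SLO}}\iota\}$; it is complete if $\Sigma\models_{\mathsf{Kr}}\iota\iff\Sigma\models_{\mathsf{SLO}}\iota$ for all sp-implications $\iota$. For a frame $\mathfrak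 F$, $\mathfrak F^\star=(2^W,\cap,W,\Diamond^+_R)_R$ with $\Diamond_R^+X=\{w\mid\exists v\in X,(w,v)\in R^{\mathfrak F}\}$. A spi-logic $L$ is complex if every SLO validating $L$ embeds (injectively, preserving $\wedge,\top,\Diamond_R$) into $\mathfrak F^\star$ for some frame $\mathfrak F$ validating $L$. The tree model $\mathfrak M_\varrho=(\mathfrak T_\varrho,\mathfrak v_\varrho)$ of an sp-formula $\varrho$, with $\mathfrak T_\varrho=(W_\varrho,R_\varrho)_{R\in\mathcal R}$ a finite tree with root $r_\varrho$, is defined inductively: for $\varrho=\top$ it is a single irreflexive point with all variables false; for $\varrho=p$ a single irreflexive point $r_\varrho$ with $\mathfrak v_\varrho(p)=\{r_\varrho\}$ and all other variables false; for $\varrho=\varrho_1\wedge\varrho_2$ take disjoint $\mathfrak M_{\varrho_1},\mathfrak M_{\varrho_2}$ and merge their roots into $r_\varrho$, which satisfies a variable iff one of the merged roots did; for $\varrho=\Diamond_R\varrho'$ add a fresh point $r_\varrho$ to $\mathfrak M_{\varrho'}$ with a single new $R$-edge from $r_\varrho$ to $r_{\varrho'}$, valuation unchanged. A leaf is a point with no successor. -}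

module Defs where

open import Algebra.Core using (Op₁)
open import Algebra.Lattice.Bundles using (BoundedMeetSemilattice)
open import Data.Bool.Base using (if_then_else_)
open import Data.Fin.Base using (Fin; zero; suc)
open import Data.Fin.Properties using (+↔⊎)
open import Data.Nat.Base using (ℕ; zero; suc; _+_)
open import Data.Nat.Properties using (_≟_)
open import Data.Product.Base using (_×_; _,_; proj₁; proj₂; ∃-syntax)
open import Data.Sum.Base using (_⊎_; inj₁; inj₂)
open import Data.Sum.Function.Propositional using (_⊎-↔_)
open import Data.Unit.Polymorphic.Base using (⊤; tt)
open import Function.Bundles using (_⇔_; _↔_; mk↔ₛ′; Inverse)
open import Function.Construct.Composition using (_↔-∘_)
open import Function.Construct.Symmetry using (↔-sym)
open import Function.Definitions using (Congruent; Injective)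
open import Level using (Level; _⊔_; 0ℓ) renaming (suc to lsuc)
open import Relation.Binary.Core using (Rel)
open import Relation.Binary.PropositionalEquality using (_≡_; refl; cong)
open import Relation.Nullary.Decidable.Core using (does)
open import Relation.Nullary.Negation.Core using (¬_)
open import Relation.Unary using (Pred; _∈_; _⊆_; _∩_; _≐_)
open import Relation.Unary.Algebra using (∩-cong; ∩-assoc; ∩-comm; ∩-idem)
open import Relation.Unary.Relation.Binary.Equality using (≐-isEquivalence)
import Relation.Binary.Construct.NaturalOrder.Left as NaturalOrder

Var : Set
Var = ℕ

infixr 7 _∧ᶠ_
infix  5 _⇒_

data SpFormula (Sig : Set) : Set where
  var  : Var → SpFormula Sig
  ⊤ᶠ   : SpFormula Sig
  _∧ᶠ_ : SpFormula Sig → SpFormula Sig → SpFormula Sig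
  ◇ᶠ   : Sig → SpFormula Sig → SpFormula Sig

record SpImplication (Sig : Set) : Set where
  constructor _⇒_
  field
    lhs rhs : SpFormula Sig

module _ {Sig : Set} where

  occurrences : Var → SpFormula Sig → ℕ
  occurrences p (var q)  = if does (p ≟ q) then 1 else 0
  occurrences p ⊤ᶠ       = 0
  occurrences p (ϱ ∧ᶠ χ) = occurrences p ϱ + occurrences p χ
  occurrences p (◇ᶠ R ϱ) = occurrences p ϱ

-- The order a ≤ b is the one induced by the meet, a ≈ a ∧ b.  That each
-- ◇ R respects ≈ follows from monotonicity and antisymmetry.
record SLO (Sig : Set) (c ℓ : Level) : Set (lsuc (c ⊔ ℓ)) where
  field
    boundedMeetSemilattice : BoundedMeetSemilattice c ℓ

  open BoundedMeetSemilattice boundedMeetSemilattice public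
  open NaturalOrder _≈_ _∧_ public using (_≤_)

  field
    ◇      : Sig → Op₁ Carrier
    ◇-mono : ∀ R {a b} → a ≤ b → ◇ R a ≤ ◇ R b

module _ {Sig : Set} {c ℓ : Level} (A : SLO Sig c ℓ) where
  open SLO A renaming (⊤ to ⊤ᴬ)

  ⟦_⟧ : SpFormula Sig → (Var → Carrier) → Carrier
  ⟦ var p ⟧  𝔞 = 𝔞 p
  ⟦ ⊤ᶠ ⟧     𝔞 = ⊤ᴬ
  ⟦ ϱ ∧ᶠ χ ⟧ 𝔞 = ⟦ ϱ ⟧ 𝔞 ∧ ⟦ χ ⟧ 𝔞
  ⟦ ◇ᶠ R ϱ ⟧ 𝔞 = ◇ R (⟦ ϱ ⟧ 𝔞)

  SLO-Valid : SpImplication Sig → Set (c ⊔ ℓ)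
  SLO-Valid (σ ⇒ τ) = ∀ (𝔞 : Var → Carrier) → ⟦ σ ⟧ 𝔞 ≤ ⟦ τ ⟧ 𝔞

record Frame (Sig : Set) (u : Level) : Set (lsuc u) where
  field
    W        : Set u
    nonempty : W
    Rel[_]   : Sig → Rel W u

module _ {Sig : Set} {u : Level} (𝔉 : Frame Sig u) where
  open Frame 𝔉

  Valuation : Set (lsuc u)
  Valuation = Var → Pred W u

  Sat : Valuation → W → SpFormula Sig → Set u
  Sat 𝔳 w (var p)  = w ∈ 𝔳 p
  Sat 𝔳 w ⊤ᶠ       = ⊤
  Sat 𝔳 w (ϱ ∧ᶠ χ) = Sat 𝔳 w ϱ × Sat 𝔳 w χ
  Sat 𝔳 w (◇ᶠ R ϱ) = ∃[ v ] (Rel[ R ] w v × Sat 𝔳 v ϱ)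

  Frame-Valid : SpImplication Sig → Set (lsuc u)
  Frame-Valid (σ ⇒ τ) = ∀ (𝔳 : Valuation) (w : W) → Sat 𝔳 w σ → Sat 𝔳 w τ

  Leaf : Pred W u
  Leaf x = ¬ (∃[ R ] ∃[ y ] Rel[ R ] x y)

  ◇⁺ : Sig → Op₁ (Pred W u)
  ◇⁺ R X w = ∃[ v ] (v ∈ X × Rel[ R ] w v)

-- The powerset 2^W is Pred W u with extensional equality _≐_.  Being
-- predicative, it lives one universe above the frame.
infix 8 _⋆

_⋆ : ∀ {Sig u} → Frame Sig u → SLO Sig (lsuc u) u
_⋆ {Sig} {u} 𝔉 = record
  { boundedMeetSemilattice = record
    { Carrier = Pred W u
    ; _≈_     = _≐_
    ; _∧_     = _∩_
    ; ⊤       = λ _ → ⊤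
    ; isBoundedMeetSemilattice = record
      { isCommutativeMonoid = record
        { isMonoid = record
          { isSemigroup = record
            { isMagma = record
              { isEquivalence = ≐-isEquivalence
              ; ∙-cong        = ∩-cong
              }
            ; assoc = ∩-assoc
            }
          ; identity = (λ _ → proj₂ , (tt ,_)) , (λ _ → proj₁ , (_, tt))
          }
        ; comm = ∩-comm
        }
      ; idem = ∩-idem
      }
    }
  ; ◇      = ◇⁺ 𝔉
  ; ◇-mono = λ R (X⊆X∩Y , _) →
      (λ z@(v , v∈X , wRv) → z , v , proj₂ (X⊆X∩Y v∈X) , wRv) , proj₁
  }
  where open Frame 𝔉

module _ {Sig : Set} where

  -- Merging the roots of two trees keeps one root and takes the disjoint
  -- union of the non-root points, so the two kinds are kept apart.
  data NonRoot : SpFormula Sig → Set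

  data TreePoint (ϱ : SpFormula Sig) : Set where
    root    : TreePoint ϱ
    nonRoot : NonRoot ϱ → TreePoint ϱ

  data NonRoot where
    inˡ : ∀ {ϱ χ} → NonRoot ϱ → NonRoot (ϱ ∧ᶠ χ)
    inʳ : ∀ {ϱ χ} → NonRoot χ → NonRoot (ϱ ∧ᶠ χ)
    in◇ : ∀ {R ϱ} → TreePoint ϱ → NonRoot (◇ᶠ R ϱ)

  ιˡ : ∀ {ϱ χ} → TreePoint ϱ → TreePoint (ϱ ∧ᶠ χ)
  ιˡ root        = root
  ιˡ (nonRoot x) = nonRoot (inˡ x)

  ιʳ : ∀ {ϱ χ} → TreePoint χ → TreePoint (ϱ ∧ᶠ χ)
  ιʳ root        = root
  ιʳ (nonRoot x) = nonRoot (inʳ x)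

  ι◇ : ∀ {R ϱ} → TreePoint ϱ → TreePoint (◇ᶠ R ϱ)
  ι◇ x = nonRoot (in◇ x)

  data Edge : (ϱ : SpFormula Sig) → Sig → Rel (TreePoint ϱ) 0ℓ where
    new   : ∀ {R ϱ} → Edge (◇ᶠ R ϱ) R root (ι◇ root)
    old   : ∀ {R S ϱ x y} → Edge ϱ S x y → Edge (◇ᶠ R ϱ) S (ι◇ x) (ι◇ y)
    left  : ∀ {S ϱ χ x y} → Edge ϱ S x y → Edge (ϱ ∧ᶠ χ) S (ιˡ x) (ιˡ y)
    right : ∀ {S ϱ χ x y} → Edge χ S x y → Edge (ϱ ∧ᶠ χ) S (ιʳ x) (ιʳ y)

  data TrueAt : (ϱ : SpFormula Sig) → Var → Pred (TreePoint ϱ) 0ℓ where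
    here  : ∀ {p} → TrueAt (var p) p root
    old   : ∀ {R p ϱ x} → TrueAt ϱ p x → TrueAt (◇ᶠ R ϱ) p (ι◇ x)
    left  : ∀ {p ϱ χ x} → TrueAt ϱ p x → TrueAt (ϱ ∧ᶠ χ) p (ιˡ x)
    right : ∀ {p ϱ χ x} → TrueAt χ p x → TrueAt (ϱ ∧ᶠ χ) p (ιʳ x)

  𝔗 : SpFormula Sig → Frame Sig 0ℓ
  𝔗 ϱ = record { W = TreePoint ϱ ; nonempty = root ; Rel[_] = Edge ϱ }

  𝔳 : (ϱ : SpFormula Sig) → Valuation (𝔗 ϱ)
  𝔳 = TrueAt

  #nonRoots : SpFormula Sig → ℕ
  #nonRoots (var p)  = 0
  #nonRoots ⊤ᶠ       = 0
  #nonRoots (ϱ ∧ᶠ χ) = #nonRoots ϱ + #nonRoots χ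
  #nonRoots (◇ᶠ R ϱ) = suc (#nonRoots ϱ)

  -- The cardinality |W_ϱ|, justified by TreePoint↔Fin.
  ∣W_∣ : SpFormula Sig → ℕ
  ∣W ϱ ∣ = suc (#nonRoots ϱ)

  private
    addRoot : ∀ {ϱ n} → NonRoot ϱ ↔ Fin n → TreePoint ϱ ↔ Fin (suc n)
    addRoot {ϱ} {n} e = mk↔ₛ′ f g f∘g g∘f
      where
      open Inverse e
      f : TreePoint ϱ → Fin (suc n)
      f root        = zero
      f (nonRoot x) = suc (to x)
      g : Fin (suc n) → TreePoint ϱ
      g zero    = root
      g (suc i) = nonRoot (from i)
      f∘g : ∀ i → f (g i) ≡ i
      f∘g zero    = refl
      f∘g (suc i) = cong suc (strictlyInverseˡ i)
      g∘f : ∀ x → g (f x) ≡ x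
      g∘f root        = refl
      g∘f (nonRoot x) = cong nonRoot (strictlyInverseʳ x)

    ∧-split : ∀ {ϱ χ} → NonRoot (ϱ ∧ᶠ χ) ↔ (NonRoot ϱ ⊎ NonRoot χ)
    ∧-split = mk↔ₛ′
      (λ { (inˡ x) → inj₁ x ; (inʳ x) → inj₂ x })
      (λ { (inj₁ x) → inˡ x ; (inj₂ x) → inʳ x })
      (λ { (inj₁ x) → refl ; (inj₂ x) → refl })
      (λ { (inˡ x) → refl ; (inʳ x) → refl })

    ◇-split : ∀ {R ϱ} → NonRoot (◇ᶠ R ϱ) ↔ TreePoint ϱ
    ◇-split = mk↔ₛ′ (λ { (in◇ x) → x }) in◇ (λ _ → refl) (λ { (in◇ x) → refl })

  NonRoot↔Fin : ∀ ϱ → NonRoot ϱ ↔ Fin (#nonRoots ϱ)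
  NonRoot↔Fin (var p)  = mk↔ₛ′ (λ ()) (λ ()) (λ ()) (λ ())
  NonRoot↔Fin ⊤ᶠ       = mk↔ₛ′ (λ ()) (λ ()) (λ ()) (λ ())
  NonRoot↔Fin (ϱ ∧ᶠ χ) =
    ↔-sym +↔⊎ ↔-∘ ((NonRoot↔Fin ϱ ⊎-↔ NonRoot↔Fin χ) ↔-∘ ∧-split)
  NonRoot↔Fin (◇ᶠ R ϱ) = addRoot (NonRoot↔Fin ϱ) ↔-∘ ◇-split

  TreePoint↔Fin : ∀ ϱ → TreePoint ϱ ↔ Fin ∣W ϱ ∣
  TreePoint↔Fin ϱ = addRoot (NonRoot↔Fin ϱ)

record Embedding {Sig : Set} {c ℓ c′ ℓ′ : Level}
                 (A : SLO Sig c ℓ) (B : SLO Sig c′ ℓ′) :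
                 Set (c ⊔ ℓ ⊔ c′ ⊔ ℓ′) where
  private
    module A = SLO A
    module B = SLO B
  field
    to        : A.Carrier → B.Carrier
    to-cong   : Congruent A._≈_ B._≈_ to
    injective : Injective A._≈_ B._≈_ to
    ∧-homo    : ∀ a b → to (a A.∧ b) B.≈ (to a B.∧ to b)
    ⊤-homo    : to A.⊤ B.≈ B.⊤
    ◇-homo    : ∀ R a → to (A.◇ R a) B.≈ B.◇ R (to a)

-- Throughout, "all SLOs" means all A : SLO Sig c ℓ, and "all frames" all
-- 𝔉 : Frame Sig (c ⊔ ℓ), for arbitrary but fixed levels c and ℓ.
module _ {Sig : Set} (c ℓ : Level) where

  ⊨SLO : ∀ {s} → Pred (SpImplication Sig) s → Pred (SpImplication Sig) (s ⊔ lsuc (c ⊔ ℓ))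
  ⊨SLO Σ ι = (A : SLO Sig c ℓ) → Σ ⊆ SLO-Valid A → SLO-Valid A ι

  ⊨Kr : ∀ {s} → Pred (SpImplication Sig) s → Pred (SpImplication Sig) (s ⊔ lsuc (c ⊔ ℓ))
  ⊨Kr Σ ι = (𝔉 : Frame Sig (c ⊔ ℓ)) → Σ ⊆ Frame-Valid 𝔉 → Frame-Valid 𝔉 ι

  SPi+ : ∀ {s} → Pred (SpImplication Sig) s → Pred (SpImplication Sig) (s ⊔ lsuc (c ⊔ ℓ))
  SPi+ Σ = ⊨SLO Σ

  -- A property of the logic SPi+ Σ, stated through its axioms Σ.
  Complete : ∀ {s} → Pred (SpImplication Sig) s → Set (s ⊔ lsuc (c ⊔ ℓ))
  Complete Σ = ∀ ι → ⊨Kr Σ ι ⇔ ⊨SLO Σ ι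

  Complex : ∀ {s} → Pred (SpImplication Sig) s → Set (s ⊔ lsuc (c ⊔ ℓ))
  Complex L = (A : SLO Sig c ℓ) → L ⊆ SLO-Valid A →
              ∃[ 𝔉 ] ((L ⊆ Frame-Valid {u = c ⊔ ℓ} 𝔉) × Embedding A (𝔉 ⋆))

{-# OPTIONS --safe #-}

-- An SLO A embeds into the complex algebra of the frame whose points are the
-- elements of A, with x R y iff x ≤ ◇ R y: send a to its down-set (y = a is
-- the best R-successor for a).  This frame validates Σ.  If x satisfies σ,
-- evaluate each variable of τ at the point realising its only occurrence in
-- σ, and the variables that occur more than once at ⊤; then x ≤ ⟦ σ ⟧ ≤ ⟦ τ ⟧.
-- The tree of τ is read back into the frame from the root x: a subtree ϱ below
-- the root is placed at the value of its variable p when ϱ is a leaf labelled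
-- by p, and at ⟦ ϱ ⟧ otherwise.
module Submission where

open import Defs
open import Data.Empty using (⊥-elim)
open import Data.Nat.Base using (ℕ; zero; suc; _≤_; z≤n; s≤s; _+_)
open import Data.Nat.Properties using (_≟_; +-identityʳ; m≤n⇒m≤n+o; m≤n⇒m≤o+n)
open import Data.Product.Base using (_×_; _,_; proj₁; proj₂; ∃-syntax)
open import Data.Sum.Base using (_⊎_; inj₁; inj₂; [_,_])
open import Data.Unit.Polymorphic.Base using (tt)
open import Function.Base using (_∘_)
open import Function.Bundles using (mk⇔)
open import Level using (Level; 0ℓ; _⊔_; Lift; lift; lower)
open import Relation.Binary.PropositionalEquality using (_≡_; _≢_; refl; sym; trans; subst; cong₂; cong)
open import Relation.Nullary.Decidable using (yes; no; dec-true; dec-false)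
open import Relation.Nullary.Negation using (¬_)
open import Relation.Unary using (Pred; _∈_; _⊆_; _∩_; Empty)
import Relation.Binary.Construct.NaturalOrder.Left as NaturalOrder

private variable
  c ℓ u : Level
  Sig : Set
  p q : Var
  ϱ σ τ : SpFormula Sig

-- Tree models

TrueAt⇒occurs : ∀ {x} → TrueAt ϱ p x → 1 ≤ occurrences p ϱ
TrueAt⇒occurs (here {p = p}) rewrite dec-true (p ≟ p) refl = s≤s z≤n
TrueAt⇒occurs (old t)               = TrueAt⇒occurs t
TrueAt⇒occurs (left {p} {ϱ} {χ} t)  = m≤n⇒m≤n+o (occurrences p χ) (TrueAt⇒occurs t)
TrueAt⇒occurs (right {p} {ϱ} {χ} t) = m≤n⇒m≤o+n (occurrences p ϱ) (TrueAt⇒occurs t)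

occurs-var : 1 ≤ occurrences {Sig} p (var q) → p ≡ q
occurs-var {p = p} {q} 1≤o with p ≟ q
... | yes p≡q = p≡q
... | no p≢q rewrite dec-false (p ≟ q) p≢q with () ← 1≤o

module _ {Sig : Set} where

  root-edge : (ϱ : SpFormula Sig) → 1 ≤ #nonRoots ϱ → ∃[ R ] ∃[ y ] Edge ϱ R root y
  root-edge (ϱ ∧ᶠ χ) 1≤n with #nonRoots ϱ in eq
  ... | zero  = let (R , _ , e) = root-edge χ 1≤n in R , _ , right e
  ... | suc _ = let (R , _ , e) = root-edge ϱ (subst (1 ≤_) (sym eq) (s≤s z≤n))
                in R , _ , left e
  root-edge (◇ᶠ R ϱ) _ = R , _ , new

  TrueAtRoot-∧ : {ϱ χ : SpFormula Sig} →
                 TrueAt (ϱ ∧ᶠ χ) p root → TrueAt ϱ p root ⊎ TrueAt χ p root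
  TrueAtRoot-∧ t = split t refl
    where
    -- The point is generalised to `x` with an equation, because `ιˡ x` and `ιʳ x` are not
    -- constructor forms and do not unify with `root`.
    split : ∀ {ϱ χ x} → TrueAt (ϱ ∧ᶠ χ) p x → x ≡ root →
            TrueAt ϱ p root ⊎ TrueAt χ p root
    split (left  {x = root} t) _ = inj₁ t
    split (right {x = root} t) _ = inj₂ t

  rootVariable? : (ϱ : SpFormula Sig) →
                  (∃[ p ] TrueAt ϱ p root) ⊎ (∀ p → ¬ TrueAt ϱ p root)
  rootVariable? (var p) = inj₁ (p , here)
  rootVariable? ⊤ᶠ      = inj₂ λ _ ()
  rootVariable? (ϱ ∧ᶠ χ) with rootVariable? ϱ | rootVariable? χ
  ... | inj₁ (p , t) | _            = inj₁ (p , left t)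
  ... | inj₂ _       | inj₁ (p , t) = inj₁ (p , right t)
  ... | inj₂ ¬ϱ      | inj₂ ¬χ      = inj₂ λ p t → [ ¬ϱ p , ¬χ p ] (TrueAtRoot-∧ t)
  rootVariable? (◇ᶠ R ϱ) = inj₂ λ _ ()

  -- The part of conditions (ii) and (iii) that subformulas inherit, so that an induction on `τ` can
  -- carry it; the bound on the number of points fails for subformulas.
  record LeafLabelled (ϱ : SpFormula Sig) : Set where
    field
      leaf     : ∀ p → 𝔳 ϱ p ⊆ Leaf (𝔗 ϱ)
      disjoint : ∀ p q → p ≢ q → Empty (𝔳 ϱ p ∩ 𝔳 ϱ q)

    unique : ∀ {x} → TrueAt ϱ q x → TrueAt ϱ p x → q ≡ p
    unique {q} {p} {x} tq tp with q ≟ p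
    ... | yes q≡p = q≡p
    ... | no q≢p  = ⊥-elim (disjoint q p q≢p x (tq , tp))

  open LeafLabelled

  LeafLabelled-∧ˡ : {ϱ χ : SpFormula Sig} → LeafLabelled (ϱ ∧ᶠ χ) → LeafLabelled ϱ
  LeafLabelled-∧ˡ l .leaf p t (R , y , e)          = l .leaf p (left t) (R , _ , left e)
  LeafLabelled-∧ˡ l .disjoint p q p≢q x (tp , tq) = l .disjoint p q p≢q _ (left tp , left tq)

  LeafLabelled-∧ʳ : {ϱ χ : SpFormula Sig} → LeafLabelled (ϱ ∧ᶠ χ) → LeafLabelled χ
  LeafLabelled-∧ʳ l .leaf p t (R , y , e)          = l .leaf p (right t) (R , _ , right e)
  LeafLabelled-∧ʳ l .disjoint p q p≢q x (tp , tq) = l .disjoint p q p≢q _ (right tp , right tq)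

  LeafLabelled-◇ : ∀ {R} {ϱ : SpFormula Sig} → LeafLabelled (◇ᶠ R ϱ) → LeafLabelled ϱ
  LeafLabelled-◇ l .leaf p t (R , y , e)          = l .leaf p (old t) (R , _ , old e)
  LeafLabelled-◇ l .disjoint p q p≢q x (tp , tq) = l .disjoint p q p≢q _ (old tp , old tq)

-- Order and evaluation in an SLO

module SLOProperties {Sig : Set} {c ℓ} (A : SLO Sig c ℓ) where
  open SLO A renaming (_≤_ to infix 4 _⊑_; refl to ≈-refl; sym to ≈-sym; trans to ≈-trans) public
  private module N = NaturalOrder _≈_ _∧_

  ⊑-refl : ∀ {a} → a ⊑ a
  ⊑-refl = N.refl ≈-sym idem

  ⊑-trans : ∀ {a b d} → a ⊑ b → b ⊑ d → a ⊑ d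
  ⊑-trans = N.trans isSemigroup

  ⊑-reflexive : ∀ {a b} → a ≈ b → a ⊑ b
  ⊑-reflexive = N.reflexive isMagma idem

  ⊑-antisym : ∀ {a b} → a ⊑ b → b ⊑ a → a ≈ b
  ⊑-antisym = N.antisym isEquivalence comm

  ⊑⊤ : ∀ {a} → a ⊑ ⊤
  ⊑⊤ {a} = ≈-sym (identityʳ a)

  ∧⊑ˡ : ∀ {a b} → a ∧ b ⊑ a
  ∧⊑ˡ = N.x∙y≤x isMeetSemilattice _ _

  ∧⊑ʳ : ∀ {a b} → a ∧ b ⊑ b
  ∧⊑ʳ = N.x∙y≤y isMeetSemilattice _ _

  ∧-greatest : ∀ {a b d} → d ⊑ a → d ⊑ b → d ⊑ a ∧ b
  ∧-greatest = N.∙-presʳ-≤ isMeetSemilattice _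

  -- The comparison is limited to occurring variables because a merged assignment need not dominate
  -- a conjunct's own assignment elsewhere.
  ⟦⟧-mono : ∀ ϱ {𝔞 𝔟 : Var → Carrier} →
            (∀ p → 1 ≤ occurrences p ϱ → 𝔞 p ⊑ 𝔟 p) → ⟦ A ⟧ ϱ 𝔞 ⊑ ⟦ A ⟧ ϱ 𝔟
  ⟦⟧-mono (var p)  𝔞⊑𝔟 = 𝔞⊑𝔟 p (TrueAt⇒occurs {Sig} {var p} here)
  ⟦⟧-mono ⊤ᶠ       𝔞⊑𝔟 = ⊑⊤
  ⟦⟧-mono (ϱ ∧ᶠ χ) 𝔞⊑𝔟 = ∧-greatest
    (⊑-trans ∧⊑ˡ (⟦⟧-mono ϱ λ p → 𝔞⊑𝔟 p ∘ m≤n⇒m≤n+o (occurrences p χ)))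
    (⊑-trans ∧⊑ʳ (⟦⟧-mono χ λ p → 𝔞⊑𝔟 p ∘ m≤n⇒m≤o+n (occurrences p ϱ)))
  ⟦⟧-mono (◇ᶠ R ϱ) 𝔞⊑𝔟 = ◇-mono R (⟦⟧-mono ϱ 𝔞⊑𝔟)

  ⟦⟧-⊑-rootVariable : ∀ ϱ (𝔞 : Var → Carrier) → TrueAt ϱ p root → ⟦ A ⟧ ϱ 𝔞 ⊑ 𝔞 p
  ⟦⟧-⊑-rootVariable (var _)  𝔞 here = ⊑-refl
  ⟦⟧-⊑-rootVariable (ϱ ∧ᶠ χ) 𝔞 t    =
    [ ⊑-trans ∧⊑ˡ ∘ ⟦⟧-⊑-rootVariable ϱ 𝔞 , ⊑-trans ∧⊑ʳ ∘ ⟦⟧-⊑-rootVariable χ 𝔞 ] (TrueAtRoot-∧ t)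

  -- When the root is a leaf, no conjunct is a diamond, so `ϱ` is a conjunction of copies of `p` and
  -- `⊤ᶠ`.
  rootVariable-⊑-⟦⟧ : ∀ ϱ (𝔞 : Var → Carrier) → Leaf (𝔗 ϱ) root →
                      (∀ q → TrueAt ϱ q root → q ≡ p) → 𝔞 p ⊑ ⟦ A ⟧ ϱ 𝔞
  rootVariable-⊑-⟦⟧ (var q) 𝔞 _ only with refl ← only q here = ⊑-refl
  rootVariable-⊑-⟦⟧ ⊤ᶠ 𝔞 _ _ = ⊑⊤
  rootVariable-⊑-⟦⟧ (ϱ ∧ᶠ χ) 𝔞 isLeaf only = ∧-greatest
    (rootVariable-⊑-⟦⟧ ϱ 𝔞 (λ (R , _ , e) → isLeaf (R , _ , left e)) (λ q → only q ∘ left))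
    (rootVariable-⊑-⟦⟧ χ 𝔞 (λ (R , _ , e) → isLeaf (R , _ , right e)) (λ q → only q ∘ right))
  rootVariable-⊑-⟦⟧ (◇ᶠ R ϱ) 𝔞 isLeaf _ = ⊥-elim (isLeaf (R , _ , new))

-- The frame of elements

module ElementFrame {Sig : Set} {c ℓ} (A : SLO Sig c ℓ) where
  open SLOProperties A

  elementFrame : Frame Sig (c ⊔ ℓ)
  elementFrame = record
    { W        = Lift ℓ Carrier
    ; nonempty = lift ⊤
    ; Rel[_]   = λ R x y → Lift c (lower x ⊑ ◇ R (lower y))
    }

  embedding : Embedding A (elementFrame ⋆)
  embedding = record
    { to        = λ a x → Lift c (lower x ⊑ a)
    ; to-cong   = λ a≈b → (λ (lift x⊑a) → lift (⊑-trans x⊑a (⊑-reflexive a≈b)))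
                        , (λ (lift x⊑b) → lift (⊑-trans x⊑b (⊑-reflexive (≈-sym a≈b))))
    -- Each down-set contains its generator, so inclusion of down-sets gives back the order.
    ; injective = λ (a⊆b , b⊆a) → ⊑-antisym (lower (a⊆b {lift _} (lift ⊑-refl)))
                                            (lower (b⊆a {lift _} (lift ⊑-refl)))
    ; ∧-homo    = λ a b → (λ (lift x⊑) → lift (⊑-trans x⊑ ∧⊑ˡ) , lift (⊑-trans x⊑ ∧⊑ʳ))
                        , (λ (lift x⊑a , lift x⊑b) → lift (∧-greatest x⊑a x⊑b))
    ; ⊤-homo    = (λ _ → tt) , (λ _ → lift ⊑⊤)
    ; ◇-homo    = λ R a → (λ (lift x⊑◇a) → lift a , lift ⊑-refl , lift x⊑◇a)
                        , (λ (_ , lift y⊑a , lift x⊑◇y) → lift (⊑-trans x⊑◇y (◇-mono R y⊑a)))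
    }

  -- The numbers count occurrences of a variable in two conjuncts. If it occurs in both, an upper
  -- bound of `a` and `b` is required; joins may be missing, so `⊤` is taken.
  merge : ℕ → ℕ → Carrier → Carrier → Carrier
  merge zero    _       a b = b
  merge (suc _) zero    a b = a
  merge (suc _) (suc _) a b = ⊤

  ⊑-mergeˡ : ∀ m n {a b} → 1 ≤ m → a ⊑ merge m n a b
  ⊑-mergeˡ (suc _) zero    _ = ⊑-refl
  ⊑-mergeˡ (suc _) (suc _) _ = ⊑⊤

  ⊑-mergeʳ : ∀ m n {a b} → 1 ≤ n → b ⊑ merge m n a b
  ⊑-mergeʳ zero    _       _ = ⊑-refl
  ⊑-mergeʳ (suc _) (suc _) _ = ⊑⊤

  merge-∈ : ∀ m n {a b} {X : Pred Carrier u} → (m ≡ 1 → a ∈ X) → (n ≡ 1 → b ∈ X) →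
            m + n ≡ 1 → merge m n a b ∈ X
  merge-∈ zero          n    _   b∈X eq = b∈X eq
  merge-∈ (suc m)       zero a∈X _   eq = a∈X (trans (sym (+-identityʳ (suc m))) eq)
  merge-∈ (suc zero)    (suc _) _ _ ()
  merge-∈ (suc (suc _)) (suc _) _ _ ()

  module _ (𝔲 : Valuation elementFrame) where

    -- Membership is claimed only for single occurrences: `𝔲` is arbitrary, and an upper bound of
    -- several points of `𝔲 p` may lie outside `𝔲 p`.
    Sat⇒assignment : ∀ σ x → Sat elementFrame 𝔲 x σ →
      ∃[ 𝔞 ] (lower x ⊑ ⟦ A ⟧ σ 𝔞 × (∀ p → occurrences p σ ≡ 1 → lift (𝔞 p) ∈ 𝔲 p))
    Sat⇒assignment (var q) x x∈q =
      (λ _ → lower x) , ⊑-refl , λ p eq →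
        subst (λ r → x ∈ 𝔲 r) (sym (occurs-var {Sig} {p} (subst (1 ≤_) (sym eq) (s≤s z≤n)))) x∈q
    Sat⇒assignment ⊤ᶠ x _ = (λ _ → ⊤) , ⊑⊤ , λ _ ()
    Sat⇒assignment (ϱ ∧ᶠ χ) x (x⊨ϱ , x⊨χ) =
      let (𝔞 , x⊑ϱ , 𝔞∈) = Sat⇒assignment ϱ x x⊨ϱ
          (𝔟 , x⊑χ , 𝔟∈) = Sat⇒assignment χ x x⊨χ
          m = λ p → occurrences p ϱ
          n = λ p → occurrences p χ
      in (λ p → merge (m p) (n p) (𝔞 p) (𝔟 p))
       , ∧-greatest (⊑-trans x⊑ϱ (⟦⟧-mono ϱ λ p → ⊑-mergeˡ (m p) (n p)))
                    (⊑-trans x⊑χ (⟦⟧-mono χ λ p → ⊑-mergeʳ (m p) (n p)))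
       , λ p → merge-∈ (m p) (n p) {X = 𝔲 p ∘ lift} (𝔞∈ p) (𝔟∈ p)
    Sat⇒assignment (◇ᶠ R ϱ) x (y , lift x⊑◇y , y⊨ϱ) =
      let (𝔞 , y⊑ϱ , 𝔞∈) = Sat⇒assignment ϱ y y⊨ϱ
      in 𝔞 , ⊑-trans x⊑◇y (◇-mono R y⊑ϱ) , 𝔞∈

    -- Since `𝔲 p` need not be downward closed, `x` lying below `𝔞 p` does not put it in `𝔲 p`;
    -- hence the separate premise on variables at the root. Below a diamond it is met by choosing
    -- the successor to be `𝔞 p` itself.
    assignment⇒Sat : ∀ τ (𝔞 : Var → Carrier) → LeafLabelled τ →
      (∀ p {y} → TrueAt τ p y → lift (𝔞 p) ∈ 𝔲 p) →
      ∀ x → lower x ⊑ ⟦ A ⟧ τ 𝔞 → (∀ p → TrueAt τ p root → x ∈ 𝔲 p) → Sat elementFrame 𝔲 x τ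
    assignment⇒Sat (var p) 𝔞 _ _ x _ x∈ = x∈ p here
    assignment⇒Sat ⊤ᶠ 𝔞 _ _ x _ _ = tt
    assignment⇒Sat (ϱ ∧ᶠ χ) 𝔞 l 𝔞∈ x x⊑ x∈ =
        assignment⇒Sat ϱ 𝔞 (LeafLabelled-∧ˡ l) (λ p → 𝔞∈ p ∘ left) x (⊑-trans x⊑ ∧⊑ˡ) (λ p → x∈ p ∘ left)
      , assignment⇒Sat χ 𝔞 (LeafLabelled-∧ʳ l) (λ p → 𝔞∈ p ∘ right) x (⊑-trans x⊑ ∧⊑ʳ) (λ p → x∈ p ∘ right)
    assignment⇒Sat (◇ᶠ R ϱ) 𝔞 l 𝔞∈ x x⊑ _ with rootVariable? ϱ
    ... | inj₁ (p , t) =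
      lift (𝔞 p) , lift (⊑-trans x⊑ (◇-mono R (⟦⟧-⊑-rootVariable ϱ 𝔞 t))) ,
      assignment⇒Sat ϱ 𝔞 l′ (λ q → 𝔞∈ q ∘ old) (lift (𝔞 p))
        (rootVariable-⊑-⟦⟧ ϱ 𝔞 (leaf p t) (λ _ t′ → unique t′ t))
        -- Disjointness makes any other label `q` of this point equal to `p`.
        (λ q t′ → subst (λ r → lift (𝔞 r) ∈ 𝔲 q) (unique t′ t) (𝔞∈ q (old t′)))
      where
      l′ : LeafLabelled ϱ
      l′ = LeafLabelled-◇ l
      open LeafLabelled l′
    ... | inj₂ none =
      lift (⟦ A ⟧ ϱ 𝔞) , lift x⊑ ,
      assignment⇒Sat ϱ 𝔞 (LeafLabelled-◇ l) (λ q → 𝔞∈ q ∘ old) (lift (⟦ A ⟧ ϱ 𝔞))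
        ⊑-refl (λ q t → ⊥-elim (none q t))

  elementFrame-valid : ∀ σ τ → (∀ p → 1 ≤ occurrences p τ → occurrences p σ ≡ 1) →
    2 ≤ ∣W τ ∣ → LeafLabelled τ → SLO-Valid A (σ ⇒ τ) → Frame-Valid elementFrame (σ ⇒ τ)
  elementFrame-valid σ τ once (s≤s 1≤n) l σ⊑τ 𝔲 x x⊨σ =
    let (𝔞 , x⊑σ , 𝔞∈) = Sat⇒assignment 𝔲 σ x x⊨σ
    in assignment⇒Sat 𝔲 τ 𝔞 l (λ p → 𝔞∈ p ∘ once p ∘ TrueAt⇒occurs) x (⊑-trans x⊑σ (σ⊑τ 𝔞))
         -- With at least two points the root has a successor, so it is no leaf and carries no
         -- variable.
         λ p t → ⊥-elim (LeafLabelled.leaf l p t (_ , proj₂ (root-edge τ 1≤n)))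

-- Derivability

-- The complex algebra 𝔉 ⋆ lives in a larger universe than the SLOs quantified
-- over in ⊨SLO, so soundness for frames does not follow by instantiating at
-- 𝔉 ⋆.  It is obtained through the Lindenbaum algebra of this calculus, which
-- is small enough to be lifted to every level.

substitute : (Var → SpFormula Sig) → SpFormula Sig → SpFormula Sig
substitute s (var p)  = s p
substitute s ⊤ᶠ       = ⊤ᶠ
substitute s (ϱ ∧ᶠ χ) = substitute s ϱ ∧ᶠ substitute s χ
substitute s (◇ᶠ R ϱ) = ◇ᶠ R (substitute s ϱ)

substitute-var : (ϱ : SpFormula Sig) → substitute var ϱ ≡ ϱ
substitute-var (var p)  = refl
substitute-var ⊤ᶠ       = refl
substitute-var (ϱ ∧ᶠ χ) = cong₂ _∧ᶠ_ (substitute-var ϱ) (substitute-var χ)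
substitute-var (◇ᶠ R ϱ) = cong (◇ᶠ R) (substitute-var ϱ)

module _ {Sig : Set} (Σ : Pred (SpImplication Sig) 0ℓ) where

  infix 4 _⊢_

  data _⊢_ : SpFormula Sig → SpFormula Sig → Set where
    ax      : ∀ {σ τ} → (σ ⇒ τ) ∈ Σ → ∀ s → substitute s σ ⊢ substitute s τ
    ⊢-refl  : ∀ {ϱ} → ϱ ⊢ ϱ
    ⊢-trans : ∀ {ϱ χ ψ} → ϱ ⊢ χ → χ ⊢ ψ → ϱ ⊢ ψ
    ⊢⊤      : ∀ {ϱ} → ϱ ⊢ ⊤ᶠ
    ∧⊢ˡ     : ∀ {ϱ χ} → ϱ ∧ᶠ χ ⊢ ϱ
    ∧⊢ʳ     : ∀ {ϱ χ} → ϱ ∧ᶠ χ ⊢ χ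
    ⊢∧      : ∀ {ϱ χ ψ} → ψ ⊢ ϱ → ψ ⊢ χ → ψ ⊢ ϱ ∧ᶠ χ
    ◇⊢◇     : ∀ R {ϱ χ} → ϱ ⊢ χ → ◇ᶠ R ϱ ⊢ ◇ᶠ R χ

  module _ (𝔉 : Frame Sig u) where

    -- Interpreting `p` by the truth set of `s p` absorbs the substitution into the valuation; this
    -- handles `ax` in the soundness proof.
    Sat-substitute⁻ : ∀ {𝔲} s ϱ {x} → Sat 𝔉 𝔲 x (substitute s ϱ) →
                      Sat 𝔉 (λ p y → Sat 𝔉 𝔲 y (s p)) x ϱ
    Sat-substitute⁻ s (var p)  h = h
    Sat-substitute⁻ s ⊤ᶠ       h = h
    Sat-substitute⁻ s (ϱ ∧ᶠ χ) (h , k) = Sat-substitute⁻ s ϱ h , Sat-substitute⁻ s χ k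
    Sat-substitute⁻ s (◇ᶠ R ϱ) (y , xRy , h) = y , xRy , Sat-substitute⁻ s ϱ h

    Sat-substitute⁺ : ∀ {𝔲} s ϱ {x} → Sat 𝔉 (λ p y → Sat 𝔉 𝔲 y (s p)) x ϱ →
                      Sat 𝔉 𝔲 x (substitute s ϱ)
    Sat-substitute⁺ s (var p)  h = h
    Sat-substitute⁺ s ⊤ᶠ       h = h
    Sat-substitute⁺ s (ϱ ∧ᶠ χ) (h , k) = Sat-substitute⁺ s ϱ h , Sat-substitute⁺ s χ k
    Sat-substitute⁺ s (◇ᶠ R ϱ) (y , xRy , h) = y , xRy , Sat-substitute⁺ s ϱ h

    ⊢-sound : Σ ⊆ Frame-Valid 𝔉 → ∀ {σ τ} → σ ⊢ τ → Frame-Valid 𝔉 (σ ⇒ τ)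
    ⊢-sound v (ax {σ} {τ} ι∈Σ s) 𝔲 x h = Sat-substitute⁺ s τ (v ι∈Σ _ x (Sat-substitute⁻ s σ h))
    ⊢-sound v ⊢-refl        𝔲 x h = h
    ⊢-sound v (⊢-trans d e) 𝔲 x h = ⊢-sound v e 𝔲 x (⊢-sound v d 𝔲 x h)
    ⊢-sound v ⊢⊤            𝔲 x h = tt
    ⊢-sound v ∧⊢ˡ           𝔲 x h = proj₁ h
    ⊢-sound v ∧⊢ʳ           𝔲 x h = proj₂ h
    ⊢-sound v (⊢∧ d e)      𝔲 x h = ⊢-sound v d 𝔲 x h , ⊢-sound v e 𝔲 x h
    ⊢-sound v (◇⊢◇ R d)     𝔲 x (y , xRy , h) = y , xRy , ⊢-sound v d 𝔲 y h

  module _ (c ℓ : Level) where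

    lindenbaum : SLO Sig c ℓ
    lindenbaum = record
      { boundedMeetSemilattice = record
        { Carrier = Lift c (SpFormula Sig)
        ; _≈_     = λ ϱ χ → Lift ℓ ((lower ϱ ⊢ lower χ) × (lower χ ⊢ lower ϱ))
        ; _∧_     = λ ϱ χ → lift (lower ϱ ∧ᶠ lower χ)
        ; ⊤       = lift ⊤ᶠ
        ; isBoundedMeetSemilattice = record
          { isCommutativeMonoid = record
            { isMonoid = record
              { isSemigroup = record
                { isMagma = record
                  { isEquivalence = record
                    { refl  = lift (⊢-refl , ⊢-refl)
                    ; sym   = λ (lift (d , e)) → lift (e , d)
                    ; trans = λ (lift (d , e)) (lift (d′ , e′)) →
                                lift (⊢-trans d d′ , ⊢-trans e′ e)
                    }
                  ; ∙-cong = λ (lift (d , e)) (lift (d′ , e′)) → lift (∧⊢∧ d d′ , ∧⊢∧ e e′)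
                  }
                ; assoc = λ _ _ _ → lift
                    ( ⊢∧ (⊢-trans ∧⊢ˡ ∧⊢ˡ) (∧⊢∧ ∧⊢ʳ ⊢-refl)
                    , ⊢∧ (∧⊢∧ ⊢-refl ∧⊢ˡ) (⊢-trans ∧⊢ʳ ∧⊢ʳ) )
                }
              ; identity = (λ _ → lift (∧⊢ʳ , ⊢∧ ⊢⊤ ⊢-refl)) , (λ _ → lift (∧⊢ˡ , ⊢∧ ⊢-refl ⊢⊤))
              }
            ; comm = λ _ _ → lift (⊢∧ ∧⊢ʳ ∧⊢ˡ , ⊢∧ ∧⊢ʳ ∧⊢ˡ)
            }
          ; idem = λ _ → lift (∧⊢ˡ , ⊢∧ ⊢-refl ⊢-refl)
          }
        }
      ; ◇      = λ R ϱ → lift (◇ᶠ R (lower ϱ))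
      -- The order unfolds to `a ≈ a ∧ b`: only the half `d` has content, the other being a
      -- projection.
      ; ◇-mono = λ R (lift (d , _)) →
                   lift (⊢∧ ⊢-refl (◇⊢◇ R (⊢-trans d ∧⊢ʳ)) , ∧⊢ˡ)
      }
      where
      ∧⊢∧ : ∀ {ϱ ϱ′ χ χ′} → ϱ ⊢ ϱ′ → χ ⊢ χ′ → ϱ ∧ᶠ χ ⊢ ϱ′ ∧ᶠ χ′
      ∧⊢∧ d e = ⊢∧ (⊢-trans ∧⊢ˡ d) (⊢-trans ∧⊢ʳ e)

    -- Valuations in this algebra are substitutions, which is why `ax` admits every `s`.
    ⟦⟧-lindenbaum : ∀ ϱ 𝔞 → lower (⟦ lindenbaum ⟧ ϱ 𝔞) ≡ substitute (lower ∘ 𝔞) ϱ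
    ⟦⟧-lindenbaum (var p)  𝔞 = refl
    ⟦⟧-lindenbaum ⊤ᶠ       𝔞 = refl
    ⟦⟧-lindenbaum (ϱ ∧ᶠ χ) 𝔞 = cong₂ _∧ᶠ_ (⟦⟧-lindenbaum ϱ 𝔞) (⟦⟧-lindenbaum χ 𝔞)
    ⟦⟧-lindenbaum (◇ᶠ R ϱ) 𝔞 = cong (◇ᶠ R) (⟦⟧-lindenbaum ϱ 𝔞)

    lindenbaum-valid : Σ ⊆ SLO-Valid lindenbaum
    lindenbaum-valid {σ ⇒ τ} ι∈Σ 𝔞
      rewrite ⟦⟧-lindenbaum σ 𝔞 | ⟦⟧-lindenbaum τ 𝔞 = lift (⊢∧ ⊢-refl (ax ι∈Σ _) , ∧⊢ˡ)

    ⊢-complete : (σ ⇒ τ) ∈ ⊨SLO c ℓ Σ → σ ⊢ τ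
    -- At the generic valuation, sending each variable to itself, a formula evaluates to itself.
    ⊢-complete {σ} {τ} ⊨ι with lower (⊨ι lindenbaum lindenbaum-valid (lift ∘ var))
    ... | d , _ rewrite ⟦⟧-lindenbaum σ (lift ∘ var) | ⟦⟧-lindenbaum τ (lift ∘ var)
                      | substitute-var σ | substitute-var τ = ⊢-trans d ∧⊢ʳ

    SPi+-sound : (𝔉 : Frame Sig u) → Σ ⊆ Frame-Valid 𝔉 → SPi+ c ℓ Σ ⊆ Frame-Valid 𝔉
    SPi+-sound 𝔉 v {σ ⇒ τ} ⊨ι = ⊢-sound 𝔉 v (⊢-complete {σ} {τ} ⊨ι)

-- Complexity implies completeness

module _ {Sig : Set} (A : SLO Sig c ℓ) (𝔉 : Frame Sig u) (E : Embedding A (𝔉 ⋆)) where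
  open SLOProperties A
  open Embedding E

  module _ (𝔞 : Var → Carrier) where

    ∈-to⇒Sat : ∀ ϱ {x} → x ∈ to (⟦ A ⟧ ϱ 𝔞) → Sat 𝔉 (to ∘ 𝔞) x ϱ
    ∈-to⇒Sat (var p)  x∈ = x∈
    ∈-to⇒Sat ⊤ᶠ       _  = tt
    ∈-to⇒Sat (ϱ ∧ᶠ χ) x∈ =
      let (h , k) = proj₁ (∧-homo _ _) x∈ in ∈-to⇒Sat ϱ h , ∈-to⇒Sat χ k
    ∈-to⇒Sat (◇ᶠ R ϱ) x∈ =
      let (y , y∈ , xRy) = proj₁ (◇-homo R _) x∈ in y , xRy , ∈-to⇒Sat ϱ y∈

    Sat⇒∈-to : ∀ ϱ {x} → Sat 𝔉 (to ∘ 𝔞) x ϱ → x ∈ to (⟦ A ⟧ ϱ 𝔞)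
    Sat⇒∈-to (var p)  h = h
    Sat⇒∈-to ⊤ᶠ       h = proj₂ ⊤-homo h
    Sat⇒∈-to (ϱ ∧ᶠ χ) (h , k) = proj₂ (∧-homo _ _) (Sat⇒∈-to ϱ h , Sat⇒∈-to χ k)
    Sat⇒∈-to (◇ᶠ R ϱ) (y , xRy , h) = proj₂ (◇-homo R _) (y , Sat⇒∈-to ϱ h , xRy)

  -- The order is the equation `a ≈ a ∧ b`, so injectivity of `to` reflects it; under `to ∘ 𝔞`,
  -- truth sets are the images of values in `A`.
  embedding-reflects-validity : ∀ ι → Frame-Valid 𝔉 ι → SLO-Valid A ι
  embedding-reflects-validity (σ ⇒ τ) v 𝔞 = injective
    ( (λ h → proj₂ (∧-homo _ _) (h , Sat⇒∈-to 𝔞 τ (v _ _ (∈-to⇒Sat 𝔞 σ h))))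
    , (λ h → proj₁ (proj₁ (∧-homo _ _) h)) )

complex⇒complete : (Σ : Pred (SpImplication Sig) 0ℓ) →
                   Complex c ℓ (SPi+ c ℓ Σ) → Complete c ℓ Σ
complex⇒complete {Sig} {c} {ℓ} Σ complex ι =
  mk⇔ Kr⇒SLO (λ ⊨ι 𝔉 𝔉⊨Σ → SPi+-sound Σ c ℓ 𝔉 𝔉⊨Σ {ι} ⊨ι)
  where
  Kr⇒SLO : ⊨Kr c ℓ Σ ι → ⊨SLO c ℓ Σ ι
  Kr⇒SLO ⊨ι A A⊨Σ =
    let (𝔉 , 𝔉⊨L , E) = complex A (λ ι∈L → ι∈L A A⊨Σ)
    -- Axioms belong to the logic they generate, so `𝔉` validates `Σ`.
    in embedding-reflects-validity A 𝔉 E ι (⊨ι 𝔉 λ {κ} κ∈Σ → 𝔉⊨L {κ} λ _ B⊨Σ → B⊨Σ κ∈Σ)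

theorem6p1 : (c ℓ : Level) (Sig : Set) → Sig →
    (Σ : Pred (SpImplication Sig) 0ℓ) →
    (∀ σ τ → (σ ⇒ τ) ∈ Σ →
    (∀ p → 1 ≤ occurrences p τ → occurrences p σ ≡ 1) ×
    (2 ≤ ∣W τ ∣ × (∀ p → 𝔳 τ p ⊆ Leaf (𝔗 τ))) ×
    (∀ p q → p ≢ q → Empty (𝔳 τ p ∩ 𝔳 τ q))) →
    Complex c ℓ (SPi+ c ℓ Σ) × Complete c ℓ Σ
theorem6p1 c ℓ Sig _ Σ conditions = complex , complex⇒complete Σ complex
  where
  complex : Complex c ℓ (SPi+ c ℓ Σ)
  -- Validating the axioms is enough: soundness extends this to the whole logic.
  complex A A⊨L = elementFrame , (λ {ι} → SPi+-sound Σ c ℓ elementFrame frame⊨Σ {ι}) , embedding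
    where
    open ElementFrame A
    frame⊨Σ : Σ ⊆ Frame-Valid elementFrame
    frame⊨Σ {σ ⇒ τ} ι∈Σ =
      let (once , (2≤W , leafy) , disj) = conditions σ τ ι∈Σ
      in elementFrame-valid σ τ once 2≤W (record { leaf = leafy ; disjoint = disj })
           (A⊨L {σ ⇒ τ} λ _ B⊨Σ → B⊨Σ ι∈Σ)
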